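{- (i) $(\mathcal{T}_2,=)\models\exists\mathsf{x}[\neg D(\mathsf{x})\wedge\forall\mathsf{y}[AP(\mathsf{x},\mathsf{y})\rightarrow D(\mathsf{y})]]$. (ii) For every $\beta$ with $Spr(\beta)$, if $(\mathcal{F}_\beta,=)\models\exists\mathsf{x}[\neg D(\mathsf{x})\wedge\forall\mathsf{y}[AP(\mathsf{x},\mathsf{y})\rightarrow D(\mathsf{y})]]$, then $\mathcal{F}_\beta$ embeds into $\mathcal{T}_2$.
   Context: Intuitionistic mathematics (constructive reading of logical constants; Markov's Principle not assumed). Axioms assumed: Brouwer's Continuity Principle (for every $R\subseteq\mathcal{N}\times\omega$, if $\forall\alpha\exists n[\alpha Rn]$ then $\forall\alpha\exists m\exists n\forall\beta[\overline{\alpha}m\sqsubset\beta\rightarrow\beta Rn]$); the First Axiom of Continuous Choice (for every $R\subseteq\mathcal{N}\times\omega$, if $\forall\alpha\exists n[\alpha Rn]$ then there is $\varphi:\mathcal{N}\rightarrow\omega$ in the sense below with $\forall\alpha[\alpha R\varphi(\alpha)]$); and the Second Axiom of Countable Choice (for every $R\subseteq\mathbb{N}\times\mathcal{N}$, if $\forall n\exists\alpha[nR\alpha]$ then $\exists\alpha\forall n[nR\alpha^n]$). Notation: $\mathcal{N}=\omega^\omega$; finite sequences coded by naturals; $\overline{\alpha}p=\langle\alpha(0),\dots,\alpha(p-1)\rangle$; $J$ a fixed pairing bijection $\omega\times\omega\to\omega$ and $\alpha^n(m):=\alpha(J(n,m))$. $\mathcal{F}_\beta:=\{\alpha\mid\forall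 n[\beta(\overline{\alpha}n)=0]\}$; $Spr(\beta)$ iff $\forall s[\beta(s)=0\leftrightarrow\exists n[\beta(s\ast\langle n\rangle)=0]]$. $\mathcal{T}_2:=\{\alpha\mid\forall i[\alpha(i)\le\alpha(i+1)<2]\}$. Formulas: $D(\mathsf{x}):=\forall\mathsf{y}[\mathsf{x}=\mathsf{y}\vee\neg(\mathsf{x}=\mathsf{y})]$, $AP(\mathsf{x},\mathsf{y}):=\forall\mathsf{z}[\neg(\mathsf{z}=\mathsf{x})\vee\neg(\mathsf{z}=\mathsf{y})]$; satisfaction read intuitionistically with $=$ interpreted as equality of sequences. For $\varphi\in\mathcal{N}$: $\varphi:\mathcal{F}_\beta\rightarrow\omega$ iff $\forall\alpha\in\mathcal{F}_\beta\exists p[\varphi(\overline{\alpha}p)\neq0]$, with $\varphi(\alpha):=\varphi(\overline{\alpha}q)-1$ for the least such $q$; $\varphi:\mathcal{F}_\beta\rightarrow\mathcal{N}$ iff $\forall n[\varphi^n:\mathcal{F}_\beta\rightarrow\omega]$, and then $\varphi|\alpha$ is the sequence $n\mapsto\varphi^n(\alpha)$; $\varphi$ is injective iff $\forall\alpha,\delta\in\mathcal{F}_\beta[\alpha\#\delta\rightarrow\varphi|\alpha\#\varphi|\delta]$, where $\alpha\#\delta$ means $\exists n[\alpha(n)\neq\delta(n)]$. $\mathcal{F}_\beta$ embeds into $X\subseteq\mathcal{N}$ iff there is an injective $\varphi:\mathcal{F}_\beta\rightarrow\mathcal{N}$ with $\varphi|\alpha\in X$ for all $\alpha\in\mathcal{F}_\beta$.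 -}

module Defs where

open import Data.Empty using (⊥; ⊥-elim-irr)
open import Data.Fin using (Fin; zero; suc)
open import Data.List using (List; applyUpTo; _∷ʳ_)
open import Data.Nat using (ℕ; zero; suc; pred; _≤_; _<_; s<s⁻¹)
open import Data.Nat.Properties using (<-cmp; 1+n≢0)
open import Data.Product using (Σ; _×_; _,_; proj₁)
open import Data.Sum using (_⊎_)
open import Data.Unit using (tt)
open import Data.Vec using (Vec; []; _∷_; lookup)
open import Function.Base using (_∘_)
open import Function.Bundles using (_⇔_; _↔_; Inverse)
open import Level using (0ℓ)
open import Relation.Binary.Definitions using (tri<; tri≈; tri>)
open import Relation.Binary.PropositionalEquality using (_≡_; _≢_; _≗_; refl; sym; trans)
open import Relation.Nullary using (Irrelevant; contradiction)
open import Relation.Unary using (Pred; U)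

-- The logical constants ∃ and ∨ are read as truncated Σ and ⊎.  Under the
-- untruncated reading the Continuity Principle is refutable (Escardó–Xu:
-- choice would make the modulus of continuity a function of α), so that
-- every theorem assuming it would be vacuous.
record Truncation : Set₁ where
  field
    ∥_∥          : Set → Set
    ∣_∣          : {A : Set} → A → ∥ A ∥
    ∥∥-irrelevant : {A : Set} → Irrelevant ∥ A ∥
    ∥∥-rec       : {A B : Set} → Irrelevant B → (A → B) → ∥ A ∥ → B

record Coding : Set where
  field
    pairing   : (ℕ × ℕ) ↔ ℕ
    sequences : List ℕ ↔ ℕ

  J : ℕ → ℕ → ℕ
  J m n = Inverse.to pairing (m , n)

  code : List ℕ → ℕ
  code = Inverse.to sequences

  decode : ℕ → List ℕ
  decode = Inverse.from sequences

𝓝 : Set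
𝓝 = ℕ → ℕ

infix 30 ¬'_
infix 25 _≐_
infixr 20 _∧'_
infixr 19 _∨'_
infixr 18 _⇒'_

-- First-order formulas of the language of equality, in de Bruijn style.
data Formula (n : ℕ) : Set where
  ⊥'             : Formula n
  _≐_            : Fin n → Fin n → Formula n
  _∧'_ _∨'_ _⇒'_ : Formula n → Formula n → Formula n
  ∀'_ ∃'_        : Formula (suc n) → Formula n

¬'_ : ∀ {n} → Formula n → Formula n
¬' A = A ⇒' ⊥'

D : ∀ {n} → Fin n → Formula n
D x = ∀' ((suc x ≐ zero) ∨' ¬' (suc x ≐ zero))

AP : ∀ {n} → Fin n → Fin n → Formula n
AP x y = ∀' (¬' (zero ≐ suc x) ∨' ¬' (zero ≐ suc y))

-- ∃x [¬ D(x) ∧ ∀y [AP(x,y) → D(y)]]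
ψ : Formula 0
ψ = ∃' (¬' (D zero) ∧' ∀' (AP (suc zero) zero ⇒' D zero))

-- The proof fields are irrelevant so that the type has at most one element
-- without function extensionality; this is what allows the least q to be
-- extracted from a truncated existence statement.
record LeastNonzero (f : ℕ → ℕ) : Set where
  constructor least
  field
    q        : ℕ
    .nonzero : f q ≢ 0
    .minimal : ∀ {i} → i < q → f i ≡ 0

LeastNonzero-irrelevant : ∀ {f} → Irrelevant (LeastNonzero f)
LeastNonzero-irrelevant (least q nz mn) (least q' nz' mn') with <-cmp q q'
... | tri< q<q' _ _ = ⊥-elim-irr (nz (mn' q<q'))
... | tri≈ _ refl _ = refl
... | tri> _ _ q'<q = ⊥-elim-irr (nz' (mn q'<q))

leastNonzero : ∀ f p → f p ≢ 0 → LeastNonzero f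
leastNonzero f p fp≢0 with f 0 in eq
leastNonzero f p       fp≢0 | suc k = least 0 (λ f0≡0 → 1+n≢0 (trans (sym eq) f0≡0)) (λ ())
leastNonzero f zero    fp≢0 | zero  = contradiction eq fp≢0
leastNonzero f (suc p) fp≢0 | zero  with leastNonzero (f ∘ suc) p fp≢0
... | least q nz mn = least (suc q) nz (extend mn)
  where
  extend : (∀ {i} → i < q → f (suc i) ≡ 0) → ∀ {i} → i < suc q → f i ≡ 0
  extend mn {zero}  _   = eq
  extend mn {suc i} i<q = mn (s<s⁻¹ i<q)

module Intuitionistic (T : Truncation) (C : Coding) where
  open Truncation T
  open Coding C

  ∃ : {A : Set} → (A → Set) → Set
  ∃ {A} B = ∥ Σ A B ∥

  infixr 1 _∨_
  _∨_ : Set → Set → Set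
  A ∨ B = ∥ A ⊎ B ∥

  infix 4 _#_ _⊏_ _∶_⟶ω _∶_⟶𝓝

  _#_ : 𝓝 → 𝓝 → Set
  α # δ = ∃ λ n → α n ≢ δ n

  -- ᾱp, the code of ⟨α(0),…,α(p-1)⟩
  initial : 𝓝 → ℕ → ℕ
  initial α p = code (applyUpTo α p)

  _⊏_ : ℕ → 𝓝 → Set
  s ⊏ α = ∃ λ n → initial α n ≡ s

  _∗⟨_⟩ : ℕ → ℕ → ℕ
  s ∗⟨ n ⟩ = code (decode s ∷ʳ n)

  -- αⁿ
  _at_ : 𝓝 → ℕ → 𝓝
  (α at n) m = α (J n m)

  𝓕 : 𝓝 → Pred 𝓝 0ℓ
  𝓕 β α = ∀ n → β (initial α n) ≡ 0

  Spr : 𝓝 → Set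
  Spr β = ∀ s → (β s ≡ 0) ⇔ (∃ λ n → β (s ∗⟨ n ⟩) ≡ 0)

  𝓣₂ : Pred 𝓝 0ℓ
  𝓣₂ α = ∀ i → α i ≤ α (suc i) × α (suc i) < 2

  _∶_⟶ω : 𝓝 → Pred 𝓝 0ℓ → Set
  φ ∶ X ⟶ω = ∀ α → X α → ∃ λ p → φ (initial α p) ≢ 0

  -- φ(α) = φ(ᾱq) - 1 for the least q with φ(ᾱq) ≠ 0
  value : (φ α : 𝓝) → (∃ λ p → φ (initial α p) ≢ 0) → ℕ
  value φ α e = pred (φ (initial α (LeastNonzero.q first)))
    where
    first : LeastNonzero (φ ∘ initial α)
    first = ∥∥-rec LeastNonzero-irrelevant
                   (λ (p , φp≢0) → leastNonzero (φ ∘ initial α) p φp≢0) e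

  _∶_⟶𝓝 : 𝓝 → Pred 𝓝 0ℓ → Set
  φ ∶ X ⟶𝓝 = ∀ n → (φ at n) ∶ X ⟶ω

  -- φ|α
  apply : ∀ φ X → φ ∶ X ⟶𝓝 → ∀ α → X α → 𝓝
  apply φ X h α α∈X n = value (φ at n) α (h n α α∈X)

  Injective : ∀ φ X → φ ∶ X ⟶𝓝 → Set
  Injective φ X h =
    ∀ α δ (α∈X : X α) (δ∈X : X δ) →
    α # δ → apply φ X h α α∈X # apply φ X h δ δ∈X

  _embedsInto_ : Pred 𝓝 0ℓ → Pred 𝓝 0ℓ → Set
  X embedsInto Y =
    ∃ λ φ → Σ (φ ∶ X ⟶𝓝) λ h →
      Injective φ X h × (∀ α (α∈X : X α) → Y (apply φ X h α α∈X))

  -- Satisfaction in (X,=), equality of sequences being pointwise.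
  infix 3 _⊨_[_] _⊨_
  _⊨_[_] : (X : Pred 𝓝 0ℓ) → ∀ {n} → Formula n → Vec (Σ 𝓝 X) n → Set
  X ⊨ ⊥'      [ ρ ] = ⊥
  X ⊨ x ≐ y   [ ρ ] = proj₁ (lookup ρ x) ≗ proj₁ (lookup ρ y)
  X ⊨ A ∧' B  [ ρ ] = (X ⊨ A [ ρ ]) × (X ⊨ B [ ρ ])
  X ⊨ A ∨' B  [ ρ ] = (X ⊨ A [ ρ ]) ∨ (X ⊨ B [ ρ ])
  X ⊨ A ⇒' B  [ ρ ] = X ⊨ A [ ρ ] → X ⊨ B [ ρ ]
  X ⊨ ∀' A    [ ρ ] = (a : Σ 𝓝 X) → X ⊨ A [ a ∷ ρ ]
  X ⊨ ∃' A    [ ρ ] = ∃ λ (a : Σ 𝓝 X) → X ⊨ A [ a ∷ ρ ]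

  _⊨_ : Pred 𝓝 0ℓ → Formula 0 → Set
  X ⊨ A = X ⊨ A [ [] ]

  -- R ⊆ 𝓝 × ω and R ⊆ ω × 𝓝: proposition-valued relations that respect
  -- equality of sequences.
  record IsSubset𝓝×ω (R : 𝓝 → ℕ → Set) : Set where
    field
      irrelevant  : ∀ {α n} → Irrelevant (R α n)
      extensional : ∀ {α β n} → α ≗ β → R α n → R β n

  record IsSubsetω×𝓝 (R : ℕ → 𝓝 → Set) : Set where
    field
      irrelevant  : ∀ {n α} → Irrelevant (R n α)
      extensional : ∀ {n α β} → α ≗ β → R n α → R n β

  BrouwerContinuityPrinciple : Set₁
  BrouwerContinuityPrinciple =
    ∀ (R : 𝓝 → ℕ → Set) → IsSubset𝓝×ω R →
    (∀ α → ∃ λ n → R α n) →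
    ∀ α → ∃ λ m → ∃ λ n → ∀ β → initial α m ⊏ β → R β n

  FirstAxiomOfContinuousChoice : Set₁
  FirstAxiomOfContinuousChoice =
    ∀ (R : 𝓝 → ℕ → Set) → IsSubset𝓝×ω R →
    (∀ α → ∃ λ n → R α n) →
    ∃ λ φ → Σ (φ ∶ U ⟶ω) λ h → ∀ α → R α (value φ α (h α tt))

  SecondAxiomOfCountableChoice : Set₁
  SecondAxiomOfCountableChoice =
    ∀ (R : ℕ → 𝓝 → Set) → IsSubsetω×𝓝 R →
    (∀ n → ∃ λ α → R n α) →
    ∃ λ α → ∀ n → R n (α at n)

{-# OPTIONS --safe #-}
module Submission where

-- Spreads and 𝓣₂ are retracts of 𝓝, so Brouwer's principle applies to them: a
-- point with decidable equality is isolated.  In 𝓣₂ the zero sequence is not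
-- isolated, whereas a point apart from it reaches the value 1.
--
-- Conversely, let x witness ψ in 𝓕 β.  A point α with α(n) ≠ x(n) is apart
-- from x, hence isolated, and continuous choice gives a modulus M n α such
-- that the initial segment of α of length M n α determines α.  Mark the index
-- J n c for α when α(n) ≠ x(n) and c is the code of that segment.  Distinct
-- points have disjoint sets of marks, and a point differing from x has a mark.
-- The embedding sends α to the sequence that is 0 before the first mark of α
-- and 1 from there on; its continuity is again a case of continuous choice.

open import Defs
open import Data.Bool using (if_then_else_)
open import Data.Empty using (⊥; ⊥-elim)
open import Data.List using (List; []; _∷_; applyUpTo; _∷ʳ_)
open import Data.List.Properties using (applyUpTo-∷ʳ; ∷-injective)
open import Data.Nat using (ℕ; zero; suc; pred; _+_; _∸_; _⊔_; _⊓_; _≤_; _<_; z≤n; z<s; s≤s; s<s)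
open import Data.Nat.Properties
open import Data.Product using (Σ; _×_; _,_; proj₁; proj₂)
open import Data.Sum using (_⊎_; inj₁; inj₂)
open import Data.Unit using (tt)
open import Function.Base using (_∘_)
open import Function.Bundles using (Equivalence; Inverse)
open import Level using (0ℓ)
open import Relation.Binary.PropositionalEquality using (_≡_; _≢_; _≗_; refl; sym; trans; cong; cong₂; subst; subst₂)
open import Relation.Nullary using (¬_; Dec; yes; no; does; contradiction; ¬?; _×-dec_)
open import Relation.Nullary.Decidable using (recompute; dec-true; dec-false)
open import Relation.Unary using (Pred; U)

private variable
  f g : 𝓝

-- Agreement on initial segments, and 0-1 indicators.

Agree : ℕ → 𝓝 → 𝓝 → Set
Agree m f g = ∀ i → i < m → f i ≡ g i

applyUpTo-cong : ∀ m → Agree m f g → applyUpTo f m ≡ applyUpTo g m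
applyUpTo-cong zero    f≡g = refl
applyUpTo-cong (suc m) f≡g =
  cong₂ _∷_ (f≡g 0 z<s) (applyUpTo-cong m λ i i<m → f≡g (suc i) (s<s i<m))

applyUpTo-injective : ∀ m n → applyUpTo f m ≡ applyUpTo g n → Agree m f g
applyUpTo-injective (suc m) (suc n) eq zero    _         = proj₁ (∷-injective eq)
applyUpTo-injective (suc m) (suc n) eq (suc i) (s≤s i<m) =
  applyUpTo-injective m n (proj₂ (∷-injective eq)) i i<m

agree? : ∀ m f g → Agree m f g ⊎ ¬ (f ≗ g)
agree? zero    f g = inj₁ λ _ ()
agree? (suc m) f g with f 0 ≟ g 0 | agree? m (f ∘ suc) (g ∘ suc)
... | no  f₀≢g₀ | _         = inj₂ λ f≗g → f₀≢g₀ (f≗g 0)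
... | yes _     | inj₂ f≉g  = inj₂ λ f≗g → f≉g (f≗g ∘ suc)
... | yes f₀≡g₀ | inj₁ f≡g  = inj₁ λ { zero _ → f₀≡g₀ ; (suc i) (s≤s i<m) → f≡g i i<m }

LeastNonzero-resp-≗ : f ≗ g → LeastNonzero f → LeastNonzero g
LeastNonzero-resp-≗ f≗g (least q f≢0 f≡0) =
  least q (f≢0 ∘ trans (f≗g q)) (λ i<q → trans (sym (f≗g _)) (f≡0 i<q))

indicator : {A : Set} → Dec A → ℕ
indicator a? = if does a? then 1 else 0

indicator-≢0⁺ : {A : Set} (a? : Dec A) → A → indicator a? ≢ 0
indicator-≢0⁺ a? a rewrite dec-true a? a = λ ()

indicator-≢0⁻ : {A : Set} (a? : Dec A) → indicator a? ≢ 0 → A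
indicator-≢0⁻ (yes a) _  = a
indicator-≢0⁻ (no  _) ≢0 = contradiction refl ≢0

indicator-cong : {A B : Set} (a? : Dec A) (b? : Dec B) → (A → B) → (B → A) →
  indicator a? ≡ indicator b?
indicator-cong (yes a) b? to from rewrite dec-true  b? (to a)      = refl
indicator-cong (no ¬a) b? to from rewrite dec-false b? (¬a ∘ from) = refl

-- Running suprema capped at 1.

someBelow : 𝓝 → ℕ → ℕ
someBelow f zero    = 0
someBelow f (suc n) = someBelow f n ⊔ (f n ⊓ 1)

someBelow≤1 : ∀ f n → someBelow f n ≤ 1
someBelow≤1 f zero    = z≤n
someBelow≤1 f (suc n) = ⊔-lub (someBelow≤1 f n) (m⊓n≤n (f n) 1)

someBelow-cong : f ≗ g → someBelow f ≗ someBelow g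
someBelow-cong f≗g zero    = refl
someBelow-cong f≗g (suc n) =
  cong₂ (λ s a → s ⊔ (a ⊓ 1)) (someBelow-cong f≗g n) (f≗g n)

someBelow-suc≡0 : ∀ f n → someBelow f (suc n) ≡ 0 → f n ≡ 0
someBelow-suc≡0 f n eq with f n | m≤n⊔m (someBelow f n) (f n ⊓ 1)
... | zero  | _  = refl
... | suc _ | le = contradiction (≤-trans le (≤-reflexive eq)) λ ()

-- Below the first place where f or g is nonzero both suprema vanish, and at
-- that place exactly one of them becomes 1.
someBelow-separates : (∀ j → f j ≢ 0 → g j ≢ 0 → ⊥) → ∀ k →
  (Σ ℕ λ j → someBelow f (suc j) ≢ someBelow g (suc j)) ⊎
  (someBelow f k ≡ 0 × someBelow g k ≡ 0)
someBelow-separates disjoint zero = inj₂ (refl , refl)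
someBelow-separates {f} {g} disjoint (suc k) with someBelow-separates disjoint k
... | inj₁ differ = inj₁ differ
... | inj₂ (f₀ , g₀) with f k in fk | g k in gk
...   | zero  | zero  = inj₂ (cong (_⊔ 0) f₀ , cong (_⊔ 0) g₀)
...   | suc _ | suc _ = ⊥-elim (disjoint k (λ eq → 1+n≢0 (trans (sym fk) eq))
                                           (λ eq → 1+n≢0 (trans (sym gk) eq)))
...   | zero  | suc _ = inj₁ (k , differ)
  where
  differ : someBelow f (suc k) ≢ someBelow g (suc k)
  differ rewrite f₀ | g₀ | fk | gk = λ ()
...   | suc _ | zero  = inj₁ (k , differ)
  where
  differ : someBelow f (suc k) ≢ someBelow g (suc k)
  differ rewrite f₀ | g₀ | fk | gk = λ ()

module _ (T : Truncation) (C : Coding) where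
  open Truncation T
  open Coding C
  open Intuitionistic T C

  -- Truncation and evaluation of coded functions.

  infixl 1 _>>=_
  _>>=_ : {A B : Set} → ∥ A ∥ → (A → ∥ B ∥) → ∥ B ∥
  a >>= k = ∥∥-rec ∥∥-irrelevant k a

  ∥∥-map : {A B : Set} → (A → B) → ∥ A ∥ → ∥ B ∥
  ∥∥-map h a = a >>= ∣_∣ ∘ h

  ∥∥-⊥ : ¬ ∥ ⊥ ∥
  ∥∥-⊥ = ∥∥-rec (λ ()) (λ ())

  ∥∥-stable-≡ : {m n : ℕ} → ∥ m ≡ n ∥ → m ≡ n
  ∥∥-stable-≡ = ∥∥-rec ≡-irrelevant (λ eq → eq)

  code-injective : ∀ {s t} → code s ≡ code t → s ≡ t
  code-injective {s} {t} eq =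
    trans (sym (Inverse.strictlyInverseʳ sequences s))
          (trans (cong decode eq) (Inverse.strictlyInverseʳ sequences t))

  initial-cong : ∀ m → Agree m f g → initial f m ≡ initial g m
  initial-cong m f≡g = cong code (applyUpTo-cong m f≡g)

  -- The least `q` lives in the irrelevant type `LeastNonzero`, so the choice of totality proof
  -- cannot affect the value.
  value-cong : ∀ {φ χ α γ} d e → φ ∘ initial α ≗ χ ∘ initial γ → value φ α d ≡ value χ γ e
  value-cong {φ} {χ} {α} {γ} d e eq =
    trans (cong pred (eq q₁))
          (cong (pred ∘ χ ∘ initial γ ∘ LeastNonzero.q)
                (LeastNonzero-irrelevant (LeastNonzero-resp-≗ eq (first φ α d)) (first χ γ e)))
    where
    first : ∀ φ α → (∃ λ p → φ (initial α p) ≢ 0) → LeastNonzero (φ ∘ initial α)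
    first φ α = ∥∥-rec LeastNonzero-irrelevant λ (p , ≢0) → leastNonzero (φ ∘ initial α) p ≢0
    q₁ = LeastNonzero.q (first φ α d)

  -- Retractions of `𝓝` onto `𝓣₂` and onto spreads.

  record Retraction (X : Pred 𝓝 0ℓ) : Set where
    field
      retract : 𝓝 → 𝓝
      lands   : ∀ α → X (retract α)
      -- Keeps relations composed with `retract` extensional, as Brouwer's principle demands.
      resp-≗  : ∀ {α γ} → α ≗ γ → retract α ≗ retract γ
      fixes   : ∀ {α} → X α → retract α ≗ α

  𝓣₂-someBelow : ∀ f → 𝓣₂ (someBelow f ∘ suc)
  𝓣₂-someBelow f i = m≤m⊔n _ _ , s≤s (someBelow≤1 f (suc (suc i)))

  𝓣₂-retraction : Retraction 𝓣₂
  𝓣₂-retraction = record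
    { retract = λ f → someBelow f ∘ suc
    ; lands   = 𝓣₂-someBelow
    ; resp-≗  = λ f≗g → someBelow-cong f≗g ∘ suc
    ; fixes   = fixes
    }
    where
    fixes : 𝓣₂ f → someBelow f ∘ suc ≗ f
    -- Membership in `𝓣₂` bounds only successor places, so `f 0 ≤ 1` is read off from `f 1`.
    fixes     f∈ zero    = m≤n⇒m⊓n≡m (≤-trans (proj₁ (f∈ 0)) (≤-pred (proj₂ (f∈ 0))))
    fixes {f} f∈ (suc i) = trans
      (cong₂ _⊔_ (fixes f∈ i) (m≤n⇒m⊓n≡m (≤-pred (proj₂ (f∈ i)))))
      (m≤n⇒m⊔n≡n (proj₁ (f∈ i)))

  module Spread (β : 𝓝) (spr : Spr β) (β₀ : β (code []) ≡ 0) where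

    Node : Set
    Node = Σ (List ℕ) λ s → β (code s) ≡ 0

    -- The spread law gives a truncated existence; searching for the least admissible successor
    -- makes the target irrelevant, so the truncation can be eliminated.
    child : ((s , _) : Node) → Σ ℕ λ n → β (code (s ∷ʳ n)) ≡ 0
    child (s , s∈β) = toChild (∥∥-rec LeastNonzero-irrelevant
      (λ (n , n∈β) → leastNonzero children n λ eq → 1+n≢0 (trans (cong (1 ∸_) (sym (trans
        (cong (λ t → β (code (t ∷ʳ n))) (sym (Inverse.strictlyInverseʳ sequences s))) n∈β))) eq))
      (Equivalence.to (spr (code s)) s∈β))
      where
      children : 𝓝
      -- Nonzero exactly where `β` vanishes, which turns the search into one for a nonzero value.
      children n = 1 ∸ β (code (s ∷ʳ n))
      zero-child : ∀ n → children n ≢ 0 → β (code (s ∷ʳ n)) ≡ 0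
      zero-child n ≢0 with β (code (s ∷ʳ n))
      ... | zero  = refl
      ... | suc k = contradiction (0∸n≡0 k) ≢0
      toChild : LeastNonzero children → Σ ℕ λ n → β (code (s ∷ʳ n)) ≡ 0
      -- The irrelevant proof is recovered because being nonzero is decidable.
      toChild (least q nonzero _) = q , zero-child q (recompute (¬? (children q ≟ 0)) nonzero)

    choose : ((s , _) : Node) → ℕ → Σ ℕ λ n → β (code (s ∷ʳ n)) ≡ 0
    choose ν@(s , _) a with β (code (s ∷ʳ a)) ≟ 0
    ... | yes a∈β = a , a∈β
    ... | no  _   = child ν

    choose-keeps : ∀ ν a → β (code (proj₁ ν ∷ʳ a)) ≡ 0 → proj₁ (choose ν a) ≡ a
    choose-keeps (s , _) a a∈β with β (code (s ∷ʳ a)) ≟ 0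
    ... | yes _   = refl
    ... | no  a∉β = contradiction a∈β a∉β

    extend : Node → ℕ → Node
    extend ν a = proj₁ ν ∷ʳ proj₁ (choose ν a) , proj₂ (choose ν a)

    node : 𝓝 → ℕ → Node
    node α zero    = [] , β₀
    node α (suc n) = extend (node α n) (α n)

    retract : 𝓝 → 𝓝
    retract α n = proj₁ (choose (node α n) (α n))

    node-cong : ∀ {α γ} → α ≗ γ → node α ≗ node γ
    node-cong α≗γ zero    = refl
    node-cong α≗γ (suc n) = cong₂ extend (node-cong α≗γ n) (α≗γ n)

    applyUpTo-retract : ∀ α n → applyUpTo (retract α) n ≡ proj₁ (node α n)
    applyUpTo-retract α zero    = refl
    applyUpTo-retract α (suc n) = trans (sym (applyUpTo-∷ʳ (retract α) n))
      (cong (_∷ʳ retract α n) (applyUpTo-retract α n))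

    module _ {α} (α∈𝓕 : 𝓕 β α) where

      -- Simultaneous induction: while the node is an initial segment of `α`, the next value of `α`
      -- is admissible and hence kept.
      node-fixes : ∀ n → proj₁ (node α n) ≡ applyUpTo α n
      fixes      : ∀ n → retract α n ≡ α n

      node-fixes zero    = refl
      node-fixes (suc n) = trans (cong₂ _∷ʳ_ (node-fixes n) (fixes n)) (applyUpTo-∷ʳ α n)

      fixes n = choose-keeps (node α n) (α n) (trans
        (cong (β ∘ code) (trans (cong (_∷ʳ α n) (node-fixes n)) (applyUpTo-∷ʳ α n)))
        (α∈𝓕 (suc n)))

    𝓕-retraction : Retraction (𝓕 β)
    𝓕-retraction = record
      { retract = retract
      ; lands   = λ α n → trans (cong (β ∘ code) (applyUpTo-retract α n)) (proj₂ (node α n))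
      ; resp-≗  = λ α≗γ n → cong₂ (λ ν a → proj₁ (choose ν a)) (node-cong α≗γ n) (α≗γ n)
      ; fixes   = fixes
      }

  -- Consequences of Brouwer's principle.

  module _ (bcp : BrouwerContinuityPrinciple) where

    -- Composing with the retraction makes Brouwer's principle apply to X.
    local-decision : ∀ {X} → Retraction X → {P Q : Pred 𝓝 0ℓ} →
      (∀ {α γ} → α ≗ γ → P α → P γ) → (∀ {α γ} → α ≗ γ → Q α → Q γ) →
      (∀ α → X α → P α ∨ Q α) → ∀ α → X α →
      ∃ λ m → (∀ γ → X γ → Agree m γ α → ∥ P γ ∥) ⊎ (∀ γ → X γ → Agree m γ α → ∥ Q γ ∥)
    local-decision {X} ret {P} {Q} P-resp Q-resp total α α∈X =
      bcp R R-subset R-total α >>= λ (m , e) → e >>= λ (n , near) →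
      ∣ m , decide n (λ γ γ∈X γ≡α → near γ ∣ m , initial-cong m γ≡α ∣) ∣
      where
      open Retraction ret
      R : 𝓝 → ℕ → Set
      -- The number encodes the side: 0 for `P`, any other for `Q`. Brouwer's principle yields one
      -- number for all points near `α`, hence one side.
      R γ n = ∥ (n ≡ 0 × P (retract γ)) ⊎ (n ≢ 0 × Q (retract γ)) ∥
      R-subset : IsSubset𝓝×ω R
      R-subset = record
        { irrelevant  = ∥∥-irrelevant
        ; extensional = λ γ≗δ → ∥∥-map λ
            { (inj₁ (eq , p)) → inj₁ (eq , P-resp (resp-≗ γ≗δ) p)
            ; (inj₂ (ne , q)) → inj₂ (ne , Q-resp (resp-≗ γ≗δ) q) }
        }
      R-total : ∀ γ → ∃ λ n → R γ n
      R-total γ = ∥∥-map (λ { (inj₁ p) → 0 , ∣ inj₁ (refl , p) ∣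
                            ; (inj₂ q) → 1 , ∣ inj₂ ((λ ()) , q) ∣ })
                         (total (retract γ) (lands γ))
      decide : ∀ {m} n → (∀ γ → X γ → Agree m γ α → R γ n) →
        (∀ γ → X γ → Agree m γ α → ∥ P γ ∥) ⊎ (∀ γ → X γ → Agree m γ α → ∥ Q γ ∥)
      decide zero    near = inj₁ λ γ γ∈X γ≡α → near γ γ∈X γ≡α >>= λ
        { (inj₁ (_ , p))  → ∣ P-resp (fixes γ∈X) p ∣
        ; (inj₂ (ne , _)) → ⊥-elim (ne refl) }
      decide (suc n) near = inj₂ λ γ γ∈X γ≡α → near γ γ∈X γ≡α >>= λ
        { (inj₁ (() , _))
        ; (inj₂ (_ , q)) → ∣ Q-resp (fixes γ∈X) q ∣ }

    ≗-respʳ : ∀ {α γ δ : 𝓝} → γ ≗ δ → α ≗ γ → α ≗ δ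
    ≗-respʳ γ≗δ α≗γ i = trans (α≗γ i) (γ≗δ i)

    ≉-respʳ : ∀ {α γ δ : 𝓝} → γ ≗ δ → ¬ (α ≗ γ) → ¬ (α ≗ δ)
    ≉-respʳ γ≗δ α≉γ α≗δ = α≉γ (≗-respʳ (sym ∘ γ≗δ) α≗δ)

    ≉-respˡ : ∀ {α γ δ : 𝓝} → γ ≗ δ → ¬ (γ ≗ α) → ¬ (δ ≗ α)
    ≉-respˡ γ≗δ γ≉α δ≗α = γ≉α λ i → trans (γ≗δ i) (δ≗α i)

    -- Decide equality with `α` uniformly near `α`; the negative answer is refuted at `α` itself.
    isolated : ∀ {X} → Retraction X → ∀ α → X α → (∀ γ → X γ → (α ≗ γ) ∨ (¬ (α ≗ γ))) →
      ∃ λ m → ∀ γ → X γ → Agree m γ α → α ≗ γ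
    isolated ret α α∈X dec = local-decision ret ≗-respʳ ≉-respʳ dec α α∈X >>= λ
      { (m , inj₁ near) → ∣ m , (λ γ γ∈X γ≡α i → ∥∥-stable-≡ (∥∥-map (λ eq → eq i) (near γ γ∈X γ≡α))) ∣
      ; (m , inj₂ near) → ⊥-elim (∥∥-⊥ (∥∥-map (λ ne → ne λ _ → refl) (near α α∈X λ _ _ → refl))) }

    -- The sentence `ψ` holds in `𝓣₂`.

    𝓣₂⊨ψ : 𝓣₂ ⊨ ψ
    𝓣₂⊨ψ = ∣ (𝟎 , 𝟎∈𝓣₂) , not-decidable , apart-decidable ∣
      where
      𝟎 : 𝓝
      𝟎 _ = 0

      𝟎∈𝓣₂ : 𝓣₂ 𝟎
      𝟎∈𝓣₂ _ = z≤n , z<s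

      jump : ℕ → 𝓝
      -- This is 0 before place `m` and 1 from `m` on, so it agrees with `𝟎` below `m` without being
      -- equal to it.
      jump m i = 1 ∸ (m ∸ i)

      jump∈𝓣₂ : ∀ m → 𝓣₂ (jump m)
      jump∈𝓣₂ m i = ∸-monoʳ-≤ 1 (∸-monoʳ-≤ m (n≤1+n i)) , s≤s (m∸n≤m 1 (m ∸ suc i))

      not-decidable : ¬ (∀ ((γ , _) : Σ 𝓝 𝓣₂) → (𝟎 ≗ γ) ∨ (¬ (𝟎 ≗ γ)))
      not-decidable dec = ∥∥-⊥ (∥∥-map
        (λ (m , near) → contradiction (trans (near (jump m) (jump∈𝓣₂ m)
             (λ i i<m → m≤n⇒m∸n≡0 (m<n⇒0<n∸m i<m)) m) (cong (1 ∸_) (n∸n≡0 m))) λ ())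
        (isolated 𝓣₂-retraction 𝟎 𝟎∈𝓣₂ λ γ γ∈ → dec (γ , γ∈)))

      ≤1 : ∀ {γ} → 𝓣₂ γ → ∀ i → γ i ≤ 1
      ≤1 γ∈ i = ≤-trans (proj₁ (γ∈ i)) (≤-pred (proj₂ (γ∈ i)))

      mono : ∀ {γ} → 𝓣₂ γ → ∀ {i} k → γ i ≤ γ (k + i)
      mono γ∈ zero    = ≤-refl
      mono γ∈ (suc k) = ≤-trans (mono γ∈ k) (proj₁ (γ∈ _))

      stays-1 : ∀ {γ m i} → 𝓣₂ γ → γ m ≡ 1 → m ≤ i → γ i ≡ 1
      stays-1 {γ} {m} {i} γ∈ γm≡1 m≤i = ≤-antisym (≤1 γ∈ i)
        (subst (λ j → 1 ≤ γ j) (m∸n+n≡m m≤i) (≤-trans (≤-reflexive (sym γm≡1)) (mono γ∈ (i ∸ m))))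

      -- Once 1 is reached the sequence is constant, so it suffices to compare the places up to and
      -- including `m`; hence `suc m` in the test.
      decide-equal : ∀ {γ δ} m → 𝓣₂ γ → 𝓣₂ δ → γ m ≡ 1 → (γ ≗ δ) ⊎ (¬ (γ ≗ δ))
      decide-equal {γ} {δ} m γ∈ δ∈ γm≡1 with agree? (suc m) γ δ
      ... | inj₂ γ≉δ = inj₂ γ≉δ
      ... | inj₁ γ≡δ = inj₁ equal
        where
        equal : γ ≗ δ
        equal i with <-≤-connex i m
        ... | inj₁ i<m = γ≡δ i (m<n⇒m<1+n i<m)
        ... | inj₂ m≤i = trans (stays-1 γ∈ γm≡1 m≤i)
          (sym (stays-1 δ∈ (trans (sym (γ≡δ m ≤-refl)) γm≡1) m≤i))

      -- If `γ m` were 0, monotonicity would force 0 at all earlier places.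
      leaves-𝟎 : ∀ {γ} m → 𝓣₂ γ → ¬ Agree m γ 𝟎 → γ m ≡ 1
      leaves-𝟎 {γ} m γ∈ γ≉𝟎 with γ m in eq | ≤1 γ∈ m
      ... | 1           | _             = refl
      ... | suc (suc _) | s≤s ()
      ... | zero        | _             = contradiction agree γ≉𝟎
        where
        agree : Agree m γ 𝟎
        agree i i<m = n≤0⇒n≡0 (≤-trans
          (subst (λ j → γ i ≤ γ j) (m∸n+n≡m (<⇒≤ i<m)) (mono γ∈ (m ∸ i))) (≤-reflexive eq))

      apart-decidable : ∀ ((γ , _) : Σ 𝓝 𝓣₂) →
        (∀ ((δ , _) : Σ 𝓝 𝓣₂) → (¬ (δ ≗ 𝟎)) ∨ (¬ (δ ≗ γ))) →
        ∀ ((δ , _) : Σ 𝓝 𝓣₂) → (γ ≗ δ) ∨ (¬ (γ ≗ δ))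
      apart-decidable (γ , γ∈) apart (δ , δ∈) =
        -- Near `𝟎` one disjunct holds uniformly. It cannot be the first, which fails at `𝟎`; so `γ`
        -- itself is not near `𝟎` and has reached 1 at `m`.
        local-decision 𝓣₂-retraction ≉-respˡ ≉-respˡ (λ α α∈ → apart (α , α∈)) 𝟎 𝟎∈𝓣₂ >>= λ
          { (m , inj₁ near) → ⊥-elim (∥∥-⊥ (∥∥-map (λ ne → ne λ _ → refl) (near 𝟎 𝟎∈𝓣₂ λ _ _ → refl)))
          ; (m , inj₂ near) → ∣ decide-equal m γ∈ δ∈ (leaves-𝟎 m γ∈ λ γ≡𝟎 →
              ∥∥-⊥ (∥∥-map (λ ne → ne λ _ → refl) (near γ γ∈ γ≡𝟎))) ∣ }

  -- Coding extensional maps from `𝓝` to `𝓝`.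

  countable-continuous-choice : FirstAxiomOfContinuousChoice → SecondAxiomOfCountableChoice →
    (G : 𝓝 → 𝓝) → (∀ {α γ} → α ≗ γ → G α ≗ G γ) → ∀ X →
    ∃ λ φ → Σ (φ ∶ X ⟶𝓝) λ h → ∀ α (α∈X : X α) → apply φ X h α α∈X ≗ G α
  countable-continuous-choice facc sacc G G-resp X =
    ∥∥-map (λ (φ , codes) → φ , total φ codes , λ α α∈X n → ∥∥-stable-≡ (∥∥-map
               (λ (h , eq) → trans (value-cong {φ at n} {φ at n} _ _ λ _ → refl) (eq α)) (codes n)))
           -- Continuous choice codes each coordinate of `G` through its graph; countable choice
           -- gathers the codes into one `φ`.
           (sacc Codes codes-subset λ n →
             ∥∥-map (λ (φ , h , eq) → φ , ∣ h , eq ∣)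
               (facc _ (graph-subset n) λ α → ∣ G α n , refl ∣))
    where
    graph-subset : ∀ n → IsSubset𝓝×ω (λ α v → v ≡ G α n)
    graph-subset n = record
      { irrelevant = ≡-irrelevant ; extensional = λ α≗γ eq → trans eq (G-resp α≗γ n) }
    Codes : ℕ → 𝓝 → Set
    Codes n φ = ∥ (Σ (φ ∶ U ⟶ω) λ h → ∀ α → value φ α (h α tt) ≡ G α n) ∥
    codes-subset : IsSubsetω×𝓝 Codes
    codes-subset = record
      { irrelevant  = ∥∥-irrelevant
      ; extensional = λ {_} {φ} {χ} φ≗χ → ∥∥-map λ (h , eq) →
          (λ α _ → ∥∥-map (λ (p , ≢0) → p , ≢0 ∘ trans (φ≗χ _)) (h α tt)) ,
          λ α → trans (value-cong {χ} {φ} _ _ λ _ → sym (φ≗χ _)) (eq α)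
      }
    total : ∀ φ → (∀ n → Codes n (φ at n)) → φ ∶ X ⟶𝓝
    total φ codes n α _ = codes n >>= λ (h , _) → h α tt

  -- The embedding of a spread satisfying `ψ`.

  module _ (bcp : BrouwerContinuityPrinciple) (facc : FirstAxiomOfContinuousChoice)
           (sacc : SecondAxiomOfCountableChoice) (β : 𝓝) (spr : Spr β) where

    module Embedding {x : 𝓝} (x∈𝓕 : 𝓕 β x)
      (apart⇒decidable : ∀ ((α , _) : Σ 𝓝 (𝓕 β)) →
        (∀ ((γ , _) : Σ 𝓝 (𝓕 β)) → (¬ (γ ≗ x)) ∨ (¬ (γ ≗ α))) →
        ∀ ((γ , _) : Σ 𝓝 (𝓕 β)) → (α ≗ γ) ∨ (¬ (α ≗ γ))) where

      open Spread β spr (x∈𝓕 0) using (𝓕-retraction)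
      open Retraction 𝓕-retraction

      -- The premise `α n ≢ x n` is built in so that a modulus exists for every `n` and every point
      -- of the spread; where it fails, any number serves.
      IsModulus : ℕ → 𝓝 → ℕ → Set
      IsModulus n α m = α n ≢ x n → ∀ γ → 𝓕 β γ → Agree m γ α → α ≗ γ

      IsModulus-resp-≗ : ∀ {n α γ m} → α ≗ γ → IsModulus n α m → IsModulus n γ m
      IsModulus-resp-≗ {n} α≗γ mod γn≢xn δ δ∈𝓕 δ≡γ i =
        trans (sym (α≗γ i)) (mod (γn≢xn ∘ trans (sym (α≗γ n))) δ δ∈𝓕
          (λ j j<m → trans (δ≡γ j j<m) (sym (α≗γ j))) i)

      modulus-exists : ∀ n α → 𝓕 β α → ∃ (IsModulus n α)
      modulus-exists n α α∈𝓕 with α n ≟ x n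
      ... | yes αn≡xn = ∣ 0 , (λ αn≢xn → contradiction αn≡xn αn≢xn) ∣
      ... | no  αn≢xn = ∥∥-map (λ (m , iso) → m , λ _ → iso)
        (isolated bcp 𝓕-retraction α α∈𝓕 λ γ γ∈𝓕 → apart⇒decidable (α , α∈𝓕) apart (γ , γ∈𝓕))
        where
        apart : ∀ ((γ , _) : Σ 𝓝 (𝓕 β)) → (¬ (γ ≗ x)) ∨ (¬ (γ ≗ α))
        apart (γ , _) with γ n ≟ x n
        -- As `α n` and `x n` differ, comparing `γ n` with `x n` tells which of the two points `γ`
        -- is unequal to.
        ... | yes γn≡xn = ∣ inj₂ (λ γ≗α → αn≢xn (trans (sym (γ≗α n)) γn≡xn)) ∣
        ... | no  γn≢xn = ∣ inj₁ (λ γ≗x → γn≢xn (γ≗x n)) ∣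

      -- The pair of n and α is presented to continuous choice as n ◂ α.
      infixr 5 _◂_
      _◂_ : ℕ → 𝓝 → 𝓝
      (n ◂ α) zero    = n
      (n ◂ α) (suc i) = α i

      ◂-cong : ∀ n {α γ} → α ≗ γ → n ◂ α ≗ n ◂ γ
      ◂-cong n α≗γ zero    = refl
      ◂-cong n α≗γ (suc i) = α≗γ i

      -- Continuous choice ranges over all of `𝓝`, so the tail is first retracted into the spread;
      -- the truncation makes the relation proposition-valued.
      RetractModulus : 𝓝 → ℕ → Set
      RetractModulus δ m = ∥ IsModulus (δ 0) (retract (δ ∘ suc)) m ∥

      RetractModulus-subset : IsSubset𝓝×ω RetractModulus
      RetractModulus-subset = record
        { irrelevant  = ∥∥-irrelevant
        ; extensional = λ {δ} {ε} {m} δ≗ε → ∥∥-map λ mod →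
            subst (λ n → IsModulus n (retract (ε ∘ suc)) m) (δ≗ε 0)
              (IsModulus-resp-≗ (resp-≗ (δ≗ε ∘ suc)) mod)
        }

      module _ (χ : 𝓝) (χ-total : χ ∶ U ⟶ω)
               (χ-modulus : ∀ δ → RetractModulus δ (value χ δ (χ-total δ tt))) where

        M : ℕ → 𝓝 → ℕ
        M n α = value χ (n ◂ α) (χ-total (n ◂ α) tt)

        M-cong : ∀ n {α γ} → α ≗ γ → M n α ≡ M n γ
        M-cong n α≗γ = value-cong {χ} {χ} _ _ λ p →
          cong χ (initial-cong p λ i _ → ◂-cong n α≗γ i)

        M-modulus : ∀ n α → 𝓕 β α → IsModulus n α (M n α)
        M-modulus n α α∈𝓕 αn≢xn γ γ∈𝓕 γ≡α i = ∥∥-stable-≡ (∥∥-map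
          (λ mod → IsModulus-resp-≗ (fixes α∈𝓕) mod αn≢xn γ γ∈𝓕 γ≡α i)
          (χ-modulus (n ◂ α)))

        Marks : 𝓝 → ℕ → ℕ → Set
        Marks α n c = α n ≢ x n × c ≡ initial α (M n α)

        marks? : ∀ α n c → Dec (Marks α n c)
        marks? α n c = ¬? (α n ≟ x n) ×-dec (c ≟ initial α (M n α))

        Marks-resp-≗ : ∀ {α γ} n c → α ≗ γ → Marks α n c → Marks γ n c
        Marks-resp-≗ {α} {γ} n c α≗γ (αn≢xn , c≡) =
          (αn≢xn ∘ trans (α≗γ n)) ,
          trans c≡ (trans (cong (initial α) (M-cong n α≗γ)) (initial-cong (M n γ) λ i _ → α≗γ i))

        -- A code fixes the length of its list, so `γ` agrees with `α` below the modulus of `α`.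
        Marks-determine : ∀ {α γ} n c → 𝓕 β α → 𝓕 β γ → Marks α n c → Marks γ n c → α ≗ γ
        Marks-determine {α} {γ} n c α∈𝓕 γ∈𝓕 (αn≢xn , c≡α) (_ , c≡γ) =
          M-modulus n α α∈𝓕 αn≢xn γ γ∈𝓕 λ i i<m →
            sym (applyUpTo-injective (M n α) (M n γ) (code-injective (trans (sym c≡α) c≡γ)) i i<m)

        split : ℕ → ℕ × ℕ
        split = Inverse.from pairing

        marked? : ∀ α j → Dec (Marks α (proj₁ (split j)) (proj₂ (split j)))
        marked? α j = marks? α (proj₁ (split j)) (proj₂ (split j))

        marked : 𝓝 → 𝓝
        marked α j = indicator (marked? α j)

        G : 𝓝 → 𝓝
        -- The shift by `suc` lets a mark at `j` count already at place `j`.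
        G α = someBelow (marked α) ∘ suc

        G-resp-≗ : ∀ {α γ} → α ≗ γ → G α ≗ G γ
        G-resp-≗ {α} {γ} α≗γ = someBelow-cong (λ j → indicator-cong (marked? α j) (marked? γ j)
          (Marks-resp-≗ _ _ α≗γ) (Marks-resp-≗ _ _ (sym ∘ α≗γ))) ∘ suc

        G-marked : ∀ α n → α n ≢ x n → G α (J n (initial α (M n α))) ≢ 0
        G-marked α n αn≢xn G≡0 = indicator-≢0⁺ (marked? α j)
          (subst (λ (n , c) → Marks α n c) (sym (Inverse.strictlyInverseʳ pairing _)) (αn≢xn , refl))
          (someBelow-suc≡0 (marked α) j G≡0)
          where j = J n (initial α (M n α))

        -- At least one of `α n` and `γ n` differs from `x n`. That point has a mark, so the two
        -- suprema cannot both vanish just past it and must separate somewhere.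
        G-injective : ∀ α γ → 𝓕 β α → 𝓕 β γ → ∀ n → α n ≢ γ n → Σ ℕ λ j → G α j ≢ G γ j
        G-injective α γ α∈𝓕 γ∈𝓕 n αn≢γn = separate (α n ≟ x n)
          where
          disjoint : ∀ j → marked α j ≢ 0 → marked γ j ≢ 0 → ⊥
          disjoint j α-marked γ-marked = αn≢γn (Marks-determine _ _ α∈𝓕 γ∈𝓕
            (indicator-≢0⁻ (marked? α j) α-marked) (indicator-≢0⁻ (marked? γ j) γ-marked) n)
          separate : Dec (α n ≡ x n) → Σ ℕ λ j → G α j ≢ G γ j
          separate (no αn≢xn) with someBelow-separates disjoint (suc (J n (initial α (M n α))))
          ... | inj₁ differ    = differ
          ... | inj₂ (G≡0 , _) = contradiction G≡0 (G-marked α n αn≢xn)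
          separate (yes αn≡xn) with someBelow-separates disjoint (suc (J n (initial γ (M n γ))))
          ... | inj₁ differ    = differ
          ... | inj₂ (_ , G≡0) = contradiction G≡0
            (G-marked γ n λ γn≡xn → αn≢γn (trans αn≡xn (sym γn≡xn)))

        embeds-by-marks : 𝓕 β embedsInto 𝓣₂
        embeds-by-marks = ∥∥-map
          -- The coded map equals `G` only pointwise, so both properties are transported along
          -- `φ≗G`.
          (λ (φ , h , φ≗G) → φ , h ,
             (λ α γ α∈𝓕 γ∈𝓕 → ∥∥-map λ (n , αn≢γn) →
               let (j , differ) = G-injective α γ α∈𝓕 γ∈𝓕 n αn≢γn in
               j , λ eq → differ (trans (sym (φ≗G α α∈𝓕 j)) (trans eq (φ≗G γ γ∈𝓕 j)))) ,
             (λ α α∈𝓕 i → let (le , lt) = 𝓣₂-someBelow (marked α) i in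
               subst₂ _≤_ (sym (φ≗G α α∈𝓕 i)) (sym (φ≗G α α∈𝓕 (suc i))) le ,
               subst (_< 2) (sym (φ≗G α α∈𝓕 (suc i))) lt))
          (countable-continuous-choice facc sacc G G-resp-≗ (𝓕 β))

      embeds : 𝓕 β embedsInto 𝓣₂
      embeds = facc RetractModulus RetractModulus-subset
        (λ δ → ∥∥-map (λ (m , mod) → m , ∣ mod ∣)
                      (modulus-exists (δ 0) (retract (δ ∘ suc)) (lands (δ ∘ suc))))
        >>= λ (χ , χ-total , χ-modulus) → embeds-by-marks χ χ-total χ-modulus

    𝓕-embedsInto-𝓣₂ : 𝓕 β ⊨ ψ → 𝓕 β embedsInto 𝓣₂
    𝓕-embedsInto-𝓣₂ model = model >>= λ ((x , x∈𝓕) , _ , apart⇒decidable) →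
      Embedding.embeds x∈𝓕 apart⇒decidable

theorem6p6 : (T : Truncation) (C : Coding) → let open Intuitionistic T C in
    BrouwerContinuityPrinciple →
    FirstAxiomOfContinuousChoice →
    SecondAxiomOfCountableChoice →
    (𝓣₂ ⊨ ψ) × (∀ β → Spr β → 𝓕 β ⊨ ψ → 𝓕 β embedsInto 𝓣₂)
theorem6p6 T C bcp facc sacc = 𝓣₂⊨ψ T C bcp , 𝓕-embedsInto-𝓣₂ T C bcp facc sacc
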